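{- Let $\mathcal{U} = \{U_1, \ldots, U_n\}$ and $\mathcal{V} = \{V_1, \ldots, V_n\}$ be (ordered) collections of (not necessarily open, closed, or convex) sets in $\mathbb{R}^{d_1}$ and $\mathbb{R}^{d_2}$ respectively. Define $\mathcal{W} = \{W_1,\ldots, W_n\}$, a collection of sets in $\mathbb{R}^{d_1+d_2}$, where $W_i = U_i\times V_i$ for each $i$. Then $$\operatorname{code}(\mathcal{W}) = \operatorname{code}(\mathcal{U}) \sqcap \operatorname{code}(\mathcal{V}).$$
   Context: Write $[n]=\{1,\ldots,n\}$. A code is a set $\mathcal{C}\subseteq 2^{[n]}$ of subsets of $[n]$. For an ordered (indexed) collection $\mathcal{U} = \{U_1, \ldots, U_n\}$ of sets in $\mathbb{R}^d$, its code is $$\operatorname{code}(\mathcal{U}) = \{\sigma\subseteq [n] \mid \text{there exists } p\in \mathbb{R}^d \text{ such that for all } i\in[n],\ p\in U_i \text{ if and only if } i\in\sigma\}.$$ The intersection product of two codes $\mathcal{C},\mathcal{D}\subseteq 2^{[n]}$ is $\mathcal{C} \sqcap \mathcal{D} = \{ c_1 \cap c_2 \mid c_1\in \mathcal{C} \text{ and } c_2\in \mathcal{D}\}$. -}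

module Defs where

open import Data.Fin using (Fin)
open import Data.Nat using (ℕ) renaming (_+_ to _+ℕ_)
open import Data.Product using (_×_; _,_; ∃; ∃₂)
open import Data.Rational using (ℚ; _<_)
open import Data.Sum using (_⊎_)
open import Data.Vec.Functional using (Vector; take; drop)
import Data.Vec.Functional.Relation.Binary.Equality.Setoid as VecEq
open import Function.Bundles using (_⇔_; Equivalence; mk⇔)
open import Level using (Level; 0ℓ; suc; _⊔_)
open import Relation.Binary using (Setoid; IsEquivalence; _Respects_)
open import Relation.Nullary using (¬_)
open import Relation.Unary using (Pred; _∈_; _∩_; _⟨×⟩_; _≐_)
open import Relation.Unary.Properties using (≐-refl; ≐-sym; ≐-trans)
open import Relation.Unary.Relation.Binary.Equality using (≐-setoid)

private
  variable
    a ℓ ℓ₁ ℓ₂ : Level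

-- Dedekind reals: two-sided located cuts of ℚ.
record ℝ : Set₁ where
  field
    lower upper     : Pred ℚ 0ℓ
    lower-inhabited : ∃ λ q → q ∈ lower
    upper-inhabited : ∃ λ q → q ∈ upper
    lower-rounded   : ∀ q → q ∈ lower ⇔ (∃ λ r → q < r × r ∈ lower)
    upper-rounded   : ∀ q → q ∈ upper ⇔ (∃ λ r → r < q × r ∈ upper)
    disjoint        : ∀ q → ¬ (q ∈ lower × q ∈ upper)
    located         : ∀ q r → q < r → q ∈ lower ⊎ r ∈ upper

open ℝ

infix 4 _≃_

record _≃_ (x y : ℝ) : Set where
  constructor mk≃
  field
    lower≐ : lower x ≐ lower y
    upper≐ : upper x ≐ upper y

≃-isEquivalence : IsEquivalence _≃_
≃-isEquivalence = record
  { refl  = mk≃ ≐-refl ≐-refl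
  ; sym   = λ (mk≃ l u) → mk≃ (≐-sym l) (≐-sym u)
  ; trans = λ (mk≃ l u) (mk≃ l′ u′) → mk≃ (≐-trans l l′) (≐-trans u u′)
  }

ℝ-setoid : Setoid (suc 0ℓ) 0ℓ
ℝ-setoid = record { isEquivalence = ≃-isEquivalence }

ℝ^ : ℕ → Setoid (suc 0ℓ) 0ℓ
ℝ^ = VecEq.≋-setoid ℝ-setoid

-- A set in S is a predicate that does not distinguish equal elements of S.
record SetIn (S : Setoid a ℓ₁) (ℓ₂ : Level) : Set (a ⊔ ℓ₁ ⊔ suc ℓ₂) where
  open Setoid S using (Carrier; _≈_)
  field
    members  : Pred Carrier ℓ₂
    respects : members Respects _≈_

open SetIn public

-- ℝ^ (d₁ + d₂) is identified with ℝ^ d₁ × ℝ^ d₂ by splitting coordinates.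
infixr 7 _⊠_

_⊠_ : ∀ {d₁ d₂} → SetIn (ℝ^ d₁) ℓ₁ → SetIn (ℝ^ d₂) ℓ₂ →
      SetIn (ℝ^ (d₁ +ℕ d₂)) (ℓ₁ ⊔ ℓ₂)
_⊠_ {d₁ = d₁} A B = record
  { members  = λ z → (take d₁ z , drop d₁ z) ∈ (members A ⟨×⟩ members B)
  ; respects = λ z≋z′ (zA , zB) →
      respects A (λ i → z≋z′ _) zA , respects B (λ i → z≋z′ _) zB
  }

-- 2^[n], with [n] indexed from 0.  The boolean vectors of Data.Fin.Subset are
-- the decidable subsets only, and { i ∣ p ∈ Uᵢ } need not be decidable; under
-- excluded middle the two notions agree.
2^[_] : ℕ → (ℓ : Level) → Setoid (suc ℓ) ℓ
2^[ n ] ℓ = ≐-setoid (Fin n) ℓ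

Code : ℕ → (ℓ ℓ₁ : Level) → Set (suc ℓ ⊔ suc ℓ₁)
Code n ℓ ℓ₁ = SetIn (2^[ n ] ℓ) ℓ₁

code : ∀ {n d} → Vector (SetIn (ℝ^ d) ℓ) n → Code n ℓ (suc 0ℓ ⊔ ℓ)
code {d = d} U = record
  { members  = λ σ → ∃ λ (p : Setoid.Carrier (ℝ^ d)) →
                 ∀ i → p ∈ members (U i) ⇔ i ∈ σ
  ; respects = λ (σ⊆τ , τ⊆σ) (p , h) → p , λ i →
      mk⇔ (λ pU → σ⊆τ (Equivalence.to (h i) pU))
          (λ i∈τ → Equivalence.from (h i) (τ⊆σ i∈τ))
  }

infixr 7 _⊓_

_⊓_ : ∀ {n} → Code n ℓ ℓ₁ → Code n ℓ ℓ₂ → Code n ℓ (suc ℓ ⊔ ℓ₁ ⊔ ℓ₂)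
C ⊓ D = record
  { members  = λ σ → ∃₂ λ c₁ c₂ →
                 c₁ ∈ members C × c₂ ∈ members D × σ ≐ (c₁ ∩ c₂)
  ; respects = λ σ≐τ (c₁ , c₂ , c₁∈C , c₂∈D , σ≐c) →
      c₁ , c₂ , c₁∈C , c₂∈D , ≐-trans (≐-sym σ≐τ) σ≐c
  }

infix 4 _≗ᶜ_

_≗ᶜ_ : ∀ {n} → Code n ℓ ℓ₁ → Code n ℓ ℓ₂ → Set (suc ℓ ⊔ ℓ₁ ⊔ ℓ₂)
C ≗ᶜ D = members C ≐ members D

{-# OPTIONS --safe #-}
module Submission where

open import Defs
open import Data.Nat using (ℕ)
open import Data.Product using (_×_; _,_)
open import Data.Product.Function.NonDependent.Propositional using (_×-⇔_)
open import Data.Vec.Functional using (Vector; take; drop; _++_)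
open import Data.Vec.Functional.Properties using (lookup-++ˡ; lookup-++ʳ)
open import Function.Bundles using (_⇔_; Equivalence; mk⇔)
open import Function.Construct.Composition using (_⇔-∘_)
open import Function.Construct.Identity using (⇔-id)
open import Level using (Level)
open import Relation.Binary using (Setoid)
open import Relation.Unary using (_∈_)

private
  variable
    a ℓ₁ ℓ₂ : Level
    S : Setoid a ℓ₁

-- A point of the product space is a pair of points, one from each factor, and it lies in
-- `U i ⊠ V i` exactly when each half lies in its own set. So its codeword is the intersection of
-- the codewords of its halves. Cutting a point in two gives one inclusion, gluing two points the
-- other; only gluing needs a lemma, `++-∈-⊠`.

respects-⇔ : ∀ (A : SetIn S ℓ₂) {x y} → Setoid._≈_ S x y →
             x ∈ members A ⇔ y ∈ members A
respects-⇔ {S = S} A x≈y = mk⇔ (respects A x≈y) (respects A (Setoid.sym S x≈y))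

-- Splitting `p ++ q` returns `p` and `q` only coordinate by coordinate, not as identical functions,
-- so membership is carried across by the fact that sets respect equality of points.
++-∈-⊠ : ∀ {d₁ d₂} (A : SetIn (ℝ^ d₁) ℓ₁) (B : SetIn (ℝ^ d₂) ℓ₂)
         (p : Vector ℝ d₁) (q : Vector ℝ d₂) →
         (p ++ q) ∈ members (A ⊠ B) ⇔ (p ∈ members A × q ∈ members B)
++-∈-⊠ A B p q =
  respects-⇔ A (λ i → reflexive (lookup-++ˡ p q i)) ×-⇔
  respects-⇔ B (λ i → reflexive (lookup-++ʳ p q i))
  where open Setoid ℝ-setoid using (reflexive)

theorem3 : ∀ {ℓ : Level} (n d₁ d₂ : ℕ)
    (U : Vector (SetIn (ℝ^ d₁) ℓ) n) (V : Vector (SetIn (ℝ^ d₂) ℓ) n) →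
    code (λ i → U i ⊠ V i) ≗ᶜ code U ⊓ code V
theorem3 n d₁ d₂ U V = code⊆⊓ , ⊓⊆code
  where
  code⊆⊓ : ∀ {σ} → σ ∈ members (code (λ i → U i ⊠ V i)) →
           σ ∈ members (code U ⊓ code V)
  code⊆⊓ (z , z∈W⇔) =
      -- The factors are the full codewords of the two halves of `z`, so each half realises its own
      -- by definition. Membership of `z` in `U i ⊠ V i` unfolds to membership of `i` in both, and
      -- the hypothesis on `z` gives the equality with `σ`.
      (λ i → take d₁ z ∈ members (U i))
    , (λ i → drop d₁ z ∈ members (V i))
    , (take d₁ z , λ i → ⇔-id _)
    , (drop d₁ z , λ i → ⇔-id _)
    , (λ {i} → Equivalence.from (z∈W⇔ i))
    , (λ {i} → Equivalence.to (z∈W⇔ i))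

  ⊓⊆code : ∀ {σ} → σ ∈ members (code U ⊓ code V) →
           σ ∈ members (code (λ i → U i ⊠ V i))
  ⊓⊆code (c₁ , c₂ , (p , p∈U⇔) , (q , q∈V⇔) , σ⊆c , c⊆σ) =
    p ++ q , λ i →
      -- Read from right to left: unglue the point, pass to `c₁` and `c₂` in each factor, then to
      -- `σ`.
      mk⇔ c⊆σ σ⊆c ⇔-∘ ((p∈U⇔ i ×-⇔ q∈V⇔ i) ⇔-∘ ++-∈-⊠ (U i) (V i) p q)
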